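{- Let $M$ and $N$ be in $\mathcal{X}$. Let $M':=M\cup\lim(M)$ and $N':=N\cup\lim(N)$, where $\lim(M)$ denotes the set of limit points of $M$ (limit ordinals $\gamma$ with $\sup(M\cap\gamma)=\gamma$), and similarly for $\lim(N)$. Then $M'\cap N'\subseteq\beta_{M,N}$.
   Context: Standing assumptions and notation. Assume $2^{\omega_1}=\omega_2$ and fix a bijection $\pi:\omega_2\to H(\omega_2)$. $P_{\omega_1}(\omega_2)$ is the set of countable subsets of $\omega_2$. Assume there is a stationary set $\mathcal{Y}\subseteq P_{\omega_1}(\omega_2)$ which is thin, i.e. for all $\beta<\omega_2$ the set $\{a\cap\beta: a\in\mathcal{Y}\}$ has size at most $\omega_1$; fix such a $\mathcal{Y}$ which is moreover closed under initial segments ($a\in\mathcal{Y}$, $\beta<\omega_2$ imply $a\cap\beta\in\mathcal{Y}$). Let $\mathcal{A}$ be the structure $(H(\omega_2),\in,\pi,\mathcal{Y})$, which has definable Skolem functions (via the well-ordering induced by $\pi$). For $a\subseteq H(\omega_2)$, $Sk(a)$ is the closure of $a$ under a fixed set of definable Skolem functions for $\mathcal{A}$. Let $C$ be the (club) set of $\beta<\omega_2$ with $Sk(\beta)\cap\omega_2=\beta$, and let $\Lambda$ be the set of $\beta<\omega_2$ of cofinality $\omega_1$ which are limit points of $C$. Let $\mathcal{X}$ be the set of $M\in\mathcal{Y}$ such that $Sk(M)\cap\omega_2=M$ and for all $\gamma\in M$, $\sup(C\cap\gamma)\in M$. Comparison points. Fix a set $\Gamma\subseteq\Lambda$ which is stationary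 in $\omega_2$. For $M\in\mathcal{X}$, $\Gamma_M$ is the set of $\beta\in\Gamma$ such that $\beta=\min(\Gamma\setminus\sup(M\cap\beta))$, i.e. $\Gamma\cap[\sup(M\cap\beta),\beta)=\emptyset$. For $M,N\in\mathcal{X}$, $\Gamma_M\cap\Gamma_N$ has a largest element, denoted $\beta_{M,N}$. -}

module Defs where

open import Axiom.ExcludedMiddle using (ExcludedMiddle)
open import Data.Fin.Base using (Fin)
open import Data.Nat.Base using (ℕ; suc)
open import Data.Product using (∃-syntax; ∃!; _×_; proj₁)
open import Data.Sum.Base using (_⊎_)
open import Data.Vec.Base using (Vec; _∷_; lookup)
open import Data.Vec.Relation.Unary.All using (All)
open import Function.Bundles using (_⇔_)
open import Level using (Level) renaming (suc to lsuc)
open import Relation.Binary.PropositionalEquality using (_≡_)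
open import Relation.Nullary.Negation using (¬_)

-- A universe of sets with classical logic satisfying the ZFC axioms.
-- Separation and replacement are required for all Agda-level predicates and
-- relations, not merely first-order definable ones.  In particular ω is
-- standard, so formulas may be indexed by Agda's ℕ below.
record ZFC (ℓ : Level) : Set (lsuc ℓ) where
  infix 4 _∈_
  field
    V              : Set ℓ
    _∈_            : V → V → Set ℓ
    em             : ExcludedMiddle ℓ
    extensionality : ∀ x y → (∀ z → z ∈ x ⇔ z ∈ y) → x ≡ y
    foundation     : ∀ x → (∃[ y ] y ∈ x) →
                     ∃[ y ] (y ∈ x × (∀ z → z ∈ x → ¬ (z ∈ y)))
    pairing        : ∀ x y → ∃[ p ] (∀ z → z ∈ p ⇔ (z ≡ x ⊎ z ≡ y))
    union          : ∀ a → ∃[ u ] (∀ z → z ∈ u ⇔ (∃[ x ] (x ∈ a × z ∈ x)))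
    power          : ∀ a → ∃[ p ] (∀ x → x ∈ p ⇔ (∀ z → z ∈ x → z ∈ a))
    separation     : ∀ a (P : V → Set ℓ) → ∃[ b ] (∀ x → x ∈ b ⇔ (x ∈ a × P x))
    replacement    : ∀ a (R : V → V → Set ℓ) → (∀ x → x ∈ a → ∃! _≡_ (R x)) →
                     ∃[ b ] (∀ y → y ∈ b ⇔ (∃[ x ] (x ∈ a × R x y)))
    choice         : ∀ a → (∀ x → x ∈ a → ∃[ z ] z ∈ x) →
                     (∀ x y → x ∈ a → y ∈ a → (∃[ z ] (z ∈ x × z ∈ y)) → x ≡ y) →
                     ∃[ c ] (∀ x → x ∈ a → ∃! _≡_ λ z → z ∈ x × z ∈ c)

  Inductive : V → Set ℓ
  Inductive w = (∃[ e ] (e ∈ w × (∀ z → ¬ (z ∈ e)))) ×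
                (∀ x → x ∈ w → ∃[ s ] (s ∈ w × (∀ z → z ∈ s ⇔ (z ∈ x ⊎ z ≡ x))))

  field
    infinity       : ∃[ w ] Inductive w

module SetTheory {ℓ : Level} (𝕌 : ZFC ℓ) where
  open ZFC 𝕌 public

  infix  4 _⊆_ _≼_ _≺_ _≈_ _≤ₒ_
  infixl 6 _∪_
  infixl 7 _∩_ _∖_

  _⊆_ : V → V → Set ℓ
  x ⊆ y = ∀ z → z ∈ x → z ∈ y

  sep : V → (V → Set ℓ) → V
  sep a P = proj₁ (separation a P)

  ❴_,_❵ : V → V → V
  ❴ x , y ❵ = proj₁ (pairing x y)

  ⋃ : V → V
  ⋃ a = proj₁ (union a)

  𝒫 : V → V
  𝒫 a = proj₁ (power a)

  _∪_ _∩_ _∖_ : V → V → V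
  a ∪ b = ⋃ ❴ a , b ❵
  a ∩ b = sep a λ x → x ∈ b
  a ∖ b = sep a λ x → ¬ (x ∈ b)

  ω : V
  ω = sep (proj₁ infinity) λ x → ∀ w → Inductive w → x ∈ w

  -- Functions and cardinality

  ⟨_,_⟩ : V → V → V
  ⟨ x , y ⟩ = ❴ ❴ x , x ❵ , ❴ x , y ❵ ❵

  _∶_⟶_ : V → V → V → Set ℓ
  f ∶ a ⟶ b = (∀ p → p ∈ f → ∃[ x ] ∃[ y ] (x ∈ a × y ∈ b × p ≡ ⟨ x , y ⟩)) ×
              (∀ x → x ∈ a → ∃! _≡_ λ y → ⟨ x , y ⟩ ∈ f)

  Injection : V → V → V → Set ℓ
  Injection f a b =
    f ∶ a ⟶ b × (∀ x x′ y → ⟨ x , y ⟩ ∈ f → ⟨ x′ , y ⟩ ∈ f → x ≡ x′)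

  Bijection : V → V → V → Set ℓ
  Bijection f a b = Injection f a b × (∀ y → y ∈ b → ∃[ x ] ⟨ x , y ⟩ ∈ f)

  _≼_ _≺_ _≈_ : V → V → Set ℓ
  a ≼ b = ∃[ f ] Injection f a b
  a ≺ b = a ≼ b × ¬ (b ≼ a)
  a ≈ b = ∃[ f ] Bijection f a b

  Countable : V → Set ℓ
  Countable a = a ≼ ω

  Transitive : V → Set ℓ
  Transitive x = ∀ y → y ∈ x → y ⊆ x

  IsTransitiveClosure : V → V → Set ℓ
  IsTransitiveClosure t x =
    x ⊆ t × Transitive t × (∀ s → x ⊆ s → Transitive s → t ⊆ s)

  -- Ordinals; for ordinals α ∈ β is α < β, and the supremum of a set of
  -- ordinals is its union.

  -- Well-foundedness of ∈ on α is supplied by the axiom of foundation.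
  Ordinal : V → Set ℓ
  Ordinal α = Transitive α × (∀ x y → x ∈ α → y ∈ α → x ∈ y ⊎ x ≡ y ⊎ y ∈ x)

  _≤ₒ_ : V → V → Set ℓ
  α ≤ₒ β = α ∈ β ⊎ α ≡ β

  sup : V → V
  sup = ⋃

  IsLeast IsLargest : V → V → Set ℓ
  IsLeast   β a = β ∈ a × (∀ ξ → ξ ∈ a → β ≤ₒ ξ)
  IsLargest β a = β ∈ a × (∀ ξ → ξ ∈ a → ξ ≤ₒ β)

  Limit : V → Set ℓ
  Limit γ = Ordinal γ × (∃[ x ] x ∈ γ) × (∀ x → x ∈ γ → ∃[ y ] (y ∈ γ × x ∈ y))

  -- Bounding by 𝒫 (⋃ a) only serves to obtain a set:
  -- sup (a ∩ γ) ≡ γ already forces γ ⊆ ⋃ a.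
  lim : V → V
  lim a = sep (𝒫 (⋃ a)) λ γ → Limit γ × sup (a ∩ γ) ≡ γ

  CofinalMap : V → V → V → Set ℓ
  CofinalMap f δ β =
    f ∶ δ ⟶ β × (∀ ξ → ξ ∈ β → ∃[ i ] ∃[ η ] (⟨ i , η ⟩ ∈ f × ξ ≤ₒ η))

  HasCofinality : V → V → Set ℓ
  HasCofinality β κ = Ordinal κ × (∃[ f ] CofinalMap f κ β) ×
                      (∀ δ → δ ∈ κ → ¬ (∃[ f ] CofinalMap f δ β))

  -- The least ordinal κ⁺ that does not inject into κ.
  IsCardinalSuccessor : V → V → Set ℓ
  IsCardinalSuccessor κ⁺ κ = Ordinal κ⁺ × ¬ (κ⁺ ≼ κ) × (∀ α → α ∈ κ⁺ → α ≼ κ)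

  -- H(κ), for a cardinal κ
  IsH : V → V → Set ℓ
  IsH H κ = ∀ x → x ∈ H ⇔ (∃[ t ] (IsTransitiveClosure t x × t ≺ κ))

  -- Club and stationary subsets of κ

  IsClub : V → V → Set ℓ
  IsClub κ D = D ⊆ κ ×
               (∀ ξ → ξ ∈ κ → ∃[ η ] (η ∈ D × ξ ∈ η)) ×
               (∀ δ → δ ∈ κ → δ ∈ lim D → δ ∈ D)

  Stationary : V → V → Set ℓ
  Stationary κ S = S ⊆ κ × (∀ D → IsClub κ D → ∃[ x ] (x ∈ D × x ∈ S))

  -- Club and stationary subsets of P_{ω₁}(a)

  Pω₁ : V → V
  Pω₁ a = sep (𝒫 a) Countable

  Chain : V → Set ℓ
  Chain c = ∀ x y → x ∈ c → y ∈ c → x ⊆ y ⊎ y ⊆ x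

  IsClubPω₁ : V → V → Set ℓ
  IsClubPω₁ a D =
    D ⊆ Pω₁ a ×
    (∀ x → x ∈ Pω₁ a → ∃[ y ] (y ∈ D × x ⊆ y)) ×
    (∀ c → c ⊆ D → (∃[ x ] x ∈ c) → Chain c → Countable c → ⋃ c ∈ D)

  StationaryPω₁ : V → V → Set ℓ
  StationaryPω₁ a S = S ⊆ Pω₁ a × (∀ D → IsClubPω₁ a D → ∃[ x ] (x ∈ D × x ∈ S))

-- First-order formulas with n free (de Bruijn) variables in the language of
-- (H, ∈, π, 𝒴): `rel` is the graph π(x) = y and `mem𝒴` is x ∈ 𝒴.
data Formula : ℕ → Set where
  _≐_ mem rel : ∀ {n} → Fin n → Fin n → Formula n
  mem𝒴        : ∀ {n} → Fin n → Formula n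
  neg         : ∀ {n} → Formula n → Formula n
  conj        : ∀ {n} → Formula n → Formula n → Formula n
  ex          : ∀ {n} → Formula (suc n) → Formula n

module Structure {ℓ : Level} (𝕌 : ZFC ℓ) (H π 𝒴 : ZFC.V 𝕌) where
  open SetTheory 𝕌

  infix 3 _⊨_

  _⊨_ : ∀ {n} → Vec V n → Formula n → Set ℓ
  v ⊨ (i ≐ j)  = lookup v i ≡ lookup v j
  v ⊨ mem i j  = lookup v i ∈ lookup v j
  v ⊨ rel i j  = ⟨ lookup v i , lookup v j ⟩ ∈ π
  v ⊨ mem𝒴 i   = lookup v i ∈ 𝒴
  v ⊨ neg φ    = ¬ (v ⊨ φ)
  v ⊨ conj φ ψ = (v ⊨ φ) × (v ⊨ ψ)
  v ⊨ ex φ     = ∃[ x ] (x ∈ H × (x ∷ v ⊨ φ))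

  -- For each formula φ(x, v), a Skolem function v ↦ fun φ v for ∃x φ(x, v),
  -- definable in the structure without parameters.  Values of fun φ at
  -- arguments outside H are irrelevant.
  record SkolemFunctions : Set ℓ where
    field
      fun       : ∀ {n} → Formula (suc n) → Vec V n → V
      fun∈H     : ∀ {n} (φ : Formula (suc n)) v → All (_∈ H) v → fun φ v ∈ H
      skolem    : ∀ {n} (φ : Formula (suc n)) v → All (_∈ H) v →
                  (v ⊨ ex φ) → (fun φ v ∷ v ⊨ φ)
      definable : ∀ {n} (φ : Formula (suc n)) → ∃[ ψ ] (∀ x v → x ∈ H → All (_∈ H) v →
                  (x ∷ v ⊨ ψ) ⇔ (x ≡ fun φ v))

  module _ (F : SkolemFunctions) where
    open SkolemFunctions F

    data Sk (a : V) : V → Set ℓ where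
      base  : ∀ {x} → x ∈ a → Sk a x
      close : ∀ {n} (φ : Formula (suc n)) (v : Vec V n) → All (Sk a) v → Sk a (fun φ v)

-- ω₁, ω₂ and H(ω₂) are determined uniquely by their specifications.
record Setting {ℓ : Level} (𝕌 : ZFC ℓ) : Set ℓ where
  open SetTheory 𝕌
  field
    ω₁ ω₂ Hω₂        : V
    ω₁-spec          : IsCardinalSuccessor ω₁ ω
    ω₂-spec          : IsCardinalSuccessor ω₂ ω₁
    Hω₂-spec         : IsH Hω₂ ω₂
    2^ω₁≈ω₂          : 𝒫 ω₁ ≈ ω₂
    π                : V
    π-bijection      : Bijection π ω₂ Hω₂
    𝒴                : V
    𝒴-stationary     : StationaryPω₁ ω₂ 𝒴
    𝒴-thin           : ∀ β → β ∈ ω₂ →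
                       sep (𝒫 β) (λ x → ∃[ a ] (a ∈ 𝒴 × x ≡ a ∩ β)) ≼ ω₁
    𝒴-initial        : ∀ a β → a ∈ 𝒴 → β ∈ ω₂ → a ∩ β ∈ 𝒴

  open Structure 𝕌 Hω₂ π 𝒴 public using (SkolemFunctions)

  field
    skolemFunctions  : SkolemFunctions

  Sk : V → V → Set ℓ
  Sk = Structure.Sk 𝕌 Hω₂ π 𝒴 skolemFunctions

  -- Sk(a) ∩ ω₂ = a
  SkClosed : V → Set ℓ
  SkClosed a = ∀ x → (Sk a x × x ∈ ω₂) ⇔ x ∈ a

  C : V
  C = sep ω₂ SkClosed

  Λ : V
  Λ = sep ω₂ λ β → HasCofinality β ω₁ × β ∈ lim C

  𝒳 : V
  𝒳 = sep 𝒴 λ M → SkClosed M × (∀ γ → γ ∈ M → sup (C ∩ γ) ∈ M)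

  -- Γ_M
  comparison : V → V → V
  comparison Γ M = sep Γ λ β → IsLeast β (Γ ∖ sup (M ∩ β))

{-# OPTIONS --safe #-}

-- Let z ∈ M′ ∩ N′ and suppose β_{M,N} ≤ z.  Then β′, the least element of Γ
-- above z, lies in Γ_M: an element of Γ ∩ [sup(M ∩ β′), β′) could only be z
-- itself, but if z ∈ M then z + 1 ∈ M ∩ β′, and if z is a limit point of the
-- countable set M then z does not have cofinality ω₁.  Likewise β′ ∈ Γ_N,
-- against the maximality of β_{M,N}.  That z < ω₂ needs no cardinal arithmetic:
-- if M were unbounded in ω₂, then its limit points together with the successors
-- of its elements would form a club disjoint from Γ.
module Submission where

open import Defs
open import Data.Empty using (⊥-elim)
open import Data.Fin.Patterns using (0F; 1F; 2F)
open import Data.Product using (∃-syntax; _×_; _,_; proj₁; proj₂)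
open import Data.Sum.Base using (_⊎_; inj₁; inj₂; [_,_]′)
open import Data.Vec.Base using ([]; _∷_)
open import Data.Vec.Relation.Unary.All using ([]; _∷_)
open import Function.Base using (id; _∘_)
open import Function.Bundles using (_⇔_; mk⇔; Equivalence)
open import Level using (Level)
open import Relation.Binary.PropositionalEquality
  using (_≡_; _≢_; refl; sym; trans; cong; subst)
open import Relation.Nullary.Decidable.Core using (Dec; yes; no; decidable-stable)
open import Relation.Nullary.Negation using (¬_)
open Equivalence using (to; from)

module Sets {ℓ : Level} (𝕌 : ZFC ℓ) where
  open SetTheory 𝕌

  -- Elementary set operations and ordered pairs.

  by-contradiction : {P : Set ℓ} → ¬ ¬ P → P
  by-contradiction = decidable-stable em

  ∈-sep : ∀ {a x} {P : V → Set ℓ} → x ∈ sep a P ⇔ (x ∈ a × P x)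
  ∈-sep {a} {x} {P} = proj₂ (separation a P) x

  ∈-pair : ∀ {x y z} → z ∈ ❴ x , y ❵ ⇔ (z ≡ x ⊎ z ≡ y)
  ∈-pair {x} {y} {z} = proj₂ (pairing x y) z

  ∈-⋃ : ∀ {a z} → z ∈ ⋃ a ⇔ (∃[ x ] (x ∈ a × z ∈ x))
  ∈-⋃ {a} {z} = proj₂ (union a) z

  ∈-𝒫 : ∀ {a x} → x ∈ 𝒫 a ⇔ x ⊆ a
  ∈-𝒫 {a} {x} = proj₂ (power a) x

  ⊆-antisym : ∀ {x y} → x ⊆ y → y ⊆ x → x ≡ y
  ⊆-antisym p q = extensionality _ _ λ z → mk⇔ (p z) (q z)

  ∈-∪ : ∀ {a b x} → x ∈ a ∪ b ⇔ (x ∈ a ⊎ x ∈ b)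
  ∈-∪ {a} {b} {x} = mk⇔ fwd bwd
    where
    fwd : x ∈ a ∪ b → x ∈ a ⊎ x ∈ b
    fwd p with to ∈-⋃ p
    ... | c , c∈ , x∈c with to ∈-pair c∈
    ... | inj₁ refl = inj₁ x∈c
    ... | inj₂ refl = inj₂ x∈c
    bwd : x ∈ a ⊎ x ∈ b → x ∈ a ∪ b
    bwd (inj₁ p) = from ∈-⋃ (a , from ∈-pair (inj₁ refl) , p)
    bwd (inj₂ p) = from ∈-⋃ (b , from ∈-pair (inj₂ refl) , p)

  ∈-asym : ∀ {x y} → x ∈ y → ¬ (y ∈ x)
  ∈-asym {x} {y} x∈y y∈x with foundation ❴ x , y ❵ (x , from ∈-pair (inj₁ refl))
  ... | m , m∈ , min with to ∈-pair m∈
  ... | inj₁ refl = min y (from ∈-pair (inj₂ refl)) y∈x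
  ... | inj₂ refl = min x (from ∈-pair (inj₁ refl)) x∈y

  ∈-irrefl : ∀ {x} → ¬ (x ∈ x)
  ∈-irrefl p = ∈-asym p p

  -- Foundation for `{x, y, z}`: whichever element is minimal has its predecessor in the cycle as a
  -- member. This is what makes elements of ordinals transitive.
  ∈-no-3-cycle : ∀ {x y z} → x ∈ y → y ∈ z → ¬ (z ∈ x)
  ∈-no-3-cycle {x} {y} {z} x∈y y∈z z∈x with foundation T (x , x∈T)
    where
    T = ❴ x , y ❵ ∪ ❴ z , z ❵
    x∈T = from ∈-∪ (inj₁ (from ∈-pair (inj₁ refl)))
  ... | m , m∈ , min with to ∈-∪ m∈
  ... | inj₂ q with to ∈-pair q
  ...   | inj₁ refl = min y (from ∈-∪ (inj₁ (from ∈-pair (inj₂ refl)))) y∈z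
  ...   | inj₂ refl = min y (from ∈-∪ (inj₁ (from ∈-pair (inj₂ refl)))) y∈z
  ∈-no-3-cycle {x} {y} {z} x∈y y∈z z∈x | m , m∈ , min | inj₁ q with to ∈-pair q
  ...   | inj₁ refl = min z (from ∈-∪ (inj₂ (from ∈-pair (inj₁ refl)))) z∈x
  ...   | inj₂ refl = min x (from ∈-∪ (inj₁ (from ∈-pair (inj₁ refl)))) x∈y

  singleton-pair : ∀ {x y z} → ❴ x , x ❵ ≡ ❴ y , z ❵ → y ≡ x × z ≡ x
  singleton-pair {x} {y} {z} eq =
    [ id , id ]′ (to ∈-pair (subst (y ∈_) (sym eq) (from ∈-pair (inj₁ refl)))) ,
    [ id , id ]′ (to ∈-pair (subst (z ∈_) (sym eq) (from ∈-pair (inj₂ refl))))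

  pair-cancelˡ : ∀ {x y z} → ❴ x , y ❵ ≡ ❴ x , z ❵ → y ≡ z
  pair-cancelˡ {x} {y} {z} eq
    with to ∈-pair (subst (y ∈_) eq (from ∈-pair (inj₂ refl)))
       | to ∈-pair (subst (z ∈_) (sym eq) (from ∈-pair (inj₂ refl)))
  ... | inj₂ y≡z | _        = y≡z
  ... | inj₁ _   | inj₂ z≡y = sym z≡y
  ... | inj₁ y≡x | inj₁ z≡x = trans y≡x (sym z≡x)

  -- Kuratowski pairs: `❴ x , x ❵` equals one of the two members of the other pair, and either case
  -- forces `x ≡ x′`. With equal first components, cancelling the outer and then the inner pair
  -- leaves `y ≡ y′`.
  ⟨,⟩-injective : ∀ {x y x′ y′} → ⟨ x , y ⟩ ≡ ⟨ x′ , y′ ⟩ → x ≡ x′ × y ≡ y′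
  ⟨,⟩-injective {x} {y} {x′} {y′} eq = fst , snd fst eq
    where
    fst : x ≡ x′
    fst with to ∈-pair (subst (❴ x , x ❵ ∈_) eq (from ∈-pair (inj₁ refl)))
    ... | inj₁ q = sym (proj₁ (singleton-pair q))
    ... | inj₂ q = sym (proj₁ (singleton-pair q))
    snd : x ≡ x′ → ⟨ x , y ⟩ ≡ ⟨ x′ , y′ ⟩ → y ≡ y′
    snd refl e = pair-cancelˡ (pair-cancelˡ e)

  -- Functions and injections.

  -- Agda functions V → V are easier to define by cases and to compose than
  -- functions coded as sets of pairs.

  MapsTo : (V → V) → V → V → Set ℓ
  MapsTo F a b = ∀ {x} → x ∈ a → F x ∈ b

  InjectiveOn : (V → V) → V → Set ℓ
  InjectiveOn F a = ∀ {x y} → x ∈ a → y ∈ a → F x ≡ F y → x ≡ y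

  module _ (F : V → V) (a : V) where

    private
      image = replacement a (λ x p → p ≡ ⟨ x , F x ⟩)
                          (λ x _ → ⟨ x , F x ⟩ , refl , sym)

    graph : V
    graph = proj₁ image

    ∈-graph : ∀ {p} → p ∈ graph ⇔ (∃[ x ] (x ∈ a × p ≡ ⟨ x , F x ⟩))
    ∈-graph {p} = proj₂ image p

    graph-value : ∀ {x y} → ⟨ x , y ⟩ ∈ graph → x ∈ a × y ≡ F x
    graph-value p with to ∈-graph p
    ... | _ , x∈a , eq with ⟨,⟩-injective eq
    ... | refl , y≡ = x∈a , y≡

    graph-function : ∀ {b} → MapsTo F a b → graph ∶ a ⟶ b
    graph-function maps =
      (λ p p∈ → let x , x∈a , eq = to ∈-graph p∈ in x , F x , x∈a , maps x∈a , eq) ,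
      (λ x x∈a → F x , from ∈-graph (x , x∈a , refl) , sym ∘ proj₂ ∘ graph-value)

  ≼-intro : ∀ {a b} (F : V → V) → MapsTo F a b → InjectiveOn F a → a ≼ b
  ≼-intro {a} F maps inj = graph F a , graph-function F a maps , injective
    where
    injective : ∀ x x′ y → ⟨ x , y ⟩ ∈ graph F a → ⟨ x′ , y ⟩ ∈ graph F a → x ≡ x′
    injective x x′ y p q with graph-value F a p | graph-value F a q
    ... | x∈a , y≡Fx | x′∈a , y≡Fx′ = inj x∈a x′∈a (trans (sym y≡Fx) y≡Fx′)

  -- Junk value: apply f x = x outside the domain of f.
  apply : V → V → V
  apply f x with em {∃[ y ] ⟨ x , y ⟩ ∈ f}
  ... | yes (y , _) = y
  ... | no  _       = x

  apply-∈ : ∀ {f a b x} → f ∶ a ⟶ b → x ∈ a → ⟨ x , apply f x ⟩ ∈ f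
  apply-∈ {f} {x = x} (_ , total) x∈a with em {∃[ y ] ⟨ x , y ⟩ ∈ f}
  ... | yes (_ , p) = p
  ... | no  ¬p      = let y , p , _ = total x x∈a in ⊥-elim (¬p (y , p))

  ≼-elim : ∀ {a b} → a ≼ b → ∃[ F ] (MapsTo F a b × InjectiveOn F a)
  ≼-elim {a} {b} (f , fun@(pairs , _) , inj) = apply f , maps , injective
    where
    maps : MapsTo (apply f) a b
    maps x∈a with pairs _ (apply-∈ fun x∈a)
    ... | _ , _ , _ , y∈b , eq = subst (_∈ b) (sym (proj₂ (⟨,⟩-injective eq))) y∈b
    injective : InjectiveOn (apply f) a
    injective {x} {y} x∈a y∈a eq = inj x y _ (apply-∈ fun x∈a)
      (subst (λ v → ⟨ y , v ⟩ ∈ f) (sym eq) (apply-∈ fun y∈a))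

  ≼-trans : ∀ {a b c} → a ≼ b → b ≼ c → a ≼ c
  ≼-trans p q with ≼-elim p | ≼-elim q
  ... | F , mapsF , injF | G , mapsG , injG =
    ≼-intro (G ∘ F) (mapsG ∘ mapsF) λ x∈a y∈a →
      injF x∈a y∈a ∘ injG (mapsF x∈a) (mapsF y∈a)

  ⊆⇒≼ : ∀ {a b} → a ⊆ b → a ≼ b
  ⊆⇒≼ a⊆b = ≼-intro id (a⊆b _) λ _ _ → id

  -- Successors and ordinals.

  suc : V → V
  suc x = x ∪ ❴ x , x ❵

  ∈-suc : ∀ {x z} → z ∈ suc x ⇔ (z ∈ x ⊎ z ≡ x)
  ∈-suc {x} {z} = mk⇔ fwd bwd
    where
    fwd : z ∈ suc x → z ∈ x ⊎ z ≡ x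
    fwd p with to ∈-∪ p
    ... | inj₁ q = inj₁ q
    ... | inj₂ q = inj₂ ([ id , id ]′ (to ∈-pair q))
    bwd : z ∈ x ⊎ z ≡ x → z ∈ suc x
    bwd = [ from ∈-∪ ∘ inj₁ , (λ p → from ∈-∪ (inj₂ (from ∈-pair (inj₁ p)))) ]′

  ∈-suc-self : ∀ {x} → x ∈ suc x
  ∈-suc-self = from ∈-suc (inj₂ refl)

  suc-injective : ∀ {x y} → suc x ≡ suc y → x ≡ y
  suc-injective {x} {y} eq
    with to ∈-suc (subst (x ∈_) eq ∈-suc-self)
       | to ∈-suc (subst (y ∈_) (sym eq) ∈-suc-self)
  ... | inj₂ x≡y | _        = x≡y
  ... | inj₁ _   | inj₂ y≡x = sym y≡x
  ... | inj₁ x∈y | inj₁ y∈x = ⊥-elim (∈-asym x∈y y∈x)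

  suc-transitive : ∀ {x} → Transitive x → Transitive (suc x)
  suc-transitive tx y y∈ z z∈y with to ∈-suc y∈
  ... | inj₁ y∈x  = from ∈-suc (inj₁ (tx y y∈x z z∈y))
  ... | inj₂ refl = from ∈-suc (inj₁ z∈y)

  transitive-closure-self : ∀ {x} → Transitive x → IsTransitiveClosure x x
  transitive-closure-self tx = (λ _ → id) , tx , λ _ x⊆s _ → x⊆s

  ∈-ordinal : ∀ {α x} → Ordinal α → x ∈ α → Ordinal x
  ∈-ordinal {α} {x} (tα , cα) x∈α =
    transitive , λ y z y∈x z∈x → cα y z (tα x x∈α y y∈x) (tα x x∈α z z∈x)
    where
    transitive : Transitive x
    transitive y y∈x w w∈y with cα w x (tα y (tα x x∈α y y∈x) w w∈y) x∈α
    ... | inj₁ w∈x         = w∈x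
    ... | inj₂ (inj₁ refl) = ⊥-elim (∈-asym w∈y y∈x)
    ... | inj₂ (inj₂ x∈w)  = ⊥-elim (∈-no-3-cycle x∈w w∈y y∈x)

  -- An ∈-minimal element `y` of `α` outside `δ` equals `δ`: minimality gives `y ⊆ δ`, and an
  -- element of `δ` not in `y` would, by comparability and transitivity of `δ`, put `y` in `δ`.
  transitive-⊆-ordinal : ∀ {δ α} → Transitive δ → Ordinal α → δ ⊆ α → δ ≢ α → δ ∈ α
  transitive-⊆-ordinal {δ} {α} tδ (tα , cα) δ⊆α δ≢α with foundation (α ∖ δ) nonempty
    where
    nonempty : ∃[ y ] y ∈ α ∖ δ
    nonempty = by-contradiction λ empty → δ≢α (⊆-antisym δ⊆α λ z z∈α →
      by-contradiction λ z∉δ → empty (z , from ∈-sep (z∈α , z∉δ)))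
  ... | y , y∈ , min = subst (_∈ α) (⊆-antisym y⊆δ δ⊆y) y∈α
    where
    y∈α = proj₁ (to ∈-sep y∈)
    y∉δ = proj₂ (to ∈-sep y∈)
    y⊆δ : y ⊆ δ
    y⊆δ w w∈y = by-contradiction λ w∉δ → min w (from ∈-sep (tα y y∈α w w∈y , w∉δ)) w∈y
    δ⊆y : δ ⊆ y
    δ⊆y w w∈δ with cα w y (δ⊆α w w∈δ) y∈α
    ... | inj₁ w∈y         = w∈y
    ... | inj₂ (inj₁ refl) = ⊥-elim (y∉δ w∈δ)
    ... | inj₂ (inj₂ y∈w)  = ⊥-elim (y∉δ (tδ w w∈δ y y∈w))

  -- The intersection `α ∩ β` is transitive. If it differed from both `α` and `β`, it would be an
  -- element of both, hence of itself.
  ordinal-compare : ∀ {α β} → Ordinal α → Ordinal β → α ∈ β ⊎ α ≡ β ⊎ β ∈ α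
  ordinal-compare {α} {β} oα@(tα , _) oβ@(tβ , _) with em {α ∩ β ≡ α} | em {α ∩ β ≡ β}
  ... | yes eqα | yes eqβ = inj₂ (inj₁ (trans (sym eqα) eqβ))
  ... | yes eqα | no neβ  = inj₁ (transitive-⊆-ordinal tα oβ
    (λ z z∈α → proj₂ (to ∈-sep (subst (z ∈_) (sym eqα) z∈α))) λ α≡β → neβ (trans eqα α≡β))
  ... | no neα  | yes eqβ = inj₂ (inj₂ (transitive-⊆-ordinal tβ oα
    (λ z z∈β → proj₁ (to ∈-sep (subst (z ∈_) (sym eqβ) z∈β))) λ β≡α → neα (trans eqβ β≡α)))
  ... | no neα  | no neβ  = ⊥-elim (∈-irrefl (from ∈-sep
    ( transitive-⊆-ordinal tδ oα (λ z → proj₁ ∘ to ∈-sep) neα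
    , transitive-⊆-ordinal tδ oβ (λ z → proj₂ ∘ to ∈-sep) neβ)))
    where
    tδ : Transitive (α ∩ β)
    tδ y y∈ z z∈y = let y∈α , y∈β = to ∈-sep y∈ in
      from ∈-sep (tα y y∈α z z∈y , tβ y y∈β z z∈y)

  transitive-ordinal : ∀ {x} → Transitive x → (∀ y → y ∈ x → Ordinal y) → Ordinal x
  transitive-ordinal tx ord = tx , λ y z y∈x z∈x → ordinal-compare (ord y y∈x) (ord z z∈x)

  suc-ordinal : ∀ {α} → Ordinal α → Ordinal (suc α)
  suc-ordinal {α} oα = transitive-ordinal (suc-transitive (proj₁ oα)) λ y y∈ →
    [ ∈-ordinal oα , (λ { refl → oα }) ]′ (to ∈-suc y∈)

  suc-≤ : ∀ {α β} → Ordinal α → Ordinal β → α ∈ β → suc α ≤ₒ β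
  suc-≤ oα oβ α∈β with ordinal-compare (suc-ordinal oα) oβ
  ... | inj₁ p        = inj₁ p
  ... | inj₂ (inj₁ p) = inj₂ p
  ... | inj₂ (inj₂ β∈) with to ∈-suc β∈
  ...   | inj₁ β∈α  = ⊥-elim (∈-asym α∈β β∈α)
  ...   | inj₂ refl = ⊥-elim (∈-irrefl α∈β)

  suc-not-limit : ∀ {x} → ¬ Limit (suc x)
  suc-not-limit {x} (_ , _ , above) with above x ∈-suc-self
  ... | y , y∈ , x∈y with to ∈-suc y∈
  ...   | inj₁ y∈x  = ∈-asym x∈y y∈x
  ...   | inj₂ refl = ∈-irrefl x∈y

  suc-limit : ∀ {γ x} → Limit γ → x ∈ γ → suc x ∈ γ
  suc-limit lγ@(oγ , _) x∈γ with suc-≤ (∈-ordinal oγ x∈γ) oγ x∈γ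
  ... | inj₁ p    = p
  ... | inj₂ refl = ⊥-elim (suc-not-limit lγ)

  -- Foundation yields only an ∈-minimal element; linearity of `κ` makes it least.
  least-ordinal : (P : V → Set ℓ) → ∀ {κ} → Ordinal κ → ∃[ x ] (x ∈ κ × P x) →
                  ∃[ μ ] (μ ∈ κ × P μ × (∀ ξ → ξ ∈ κ → P ξ → μ ≤ₒ ξ))
  least-ordinal P {κ} (_ , cκ) (x , x∈κ , Px)
    with foundation (sep κ P) (x , from ∈-sep (x∈κ , Px))
  ... | μ , μ∈ , min = μ , μ∈κ , proj₂ (to ∈-sep μ∈) , least
    where
    μ∈κ = proj₁ (to ∈-sep μ∈)
    least : ∀ ξ → ξ ∈ κ → P ξ → μ ≤ₒ ξ
    least ξ ξ∈κ Pξ with cκ μ ξ μ∈κ ξ∈κ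
    ... | inj₁ p        = inj₁ p
    ... | inj₂ (inj₁ p) = inj₂ p
    ... | inj₂ (inj₂ p) = ⊥-elim (min ξ (from ∈-sep (ξ∈κ , Pξ)) p)

  -- Natural numbers and infinite cardinals.

  ∅ : V
  -- Here `ω ∈ ω` serves as a false proposition at level `ℓ`, refuted by foundation.
  ∅ = sep ω λ _ → ω ∈ ω

  ∈-∅ : ∀ {x} → ¬ (x ∈ ∅)
  ∈-∅ p = ∈-irrefl (proj₂ (to ∈-sep p))

  ω-zero : ∅ ∈ ω
  ω-zero = from ∈-sep (least (proj₁ infinity) (proj₂ infinity) , least)
    where
    least : ∀ w → Inductive w → ∅ ∈ w
    least w ((e , e∈w , empty) , _) = subst (_∈ w)
      (⊆-antisym (λ z z∈e → ⊥-elim (empty z z∈e)) λ z z∈∅ → ⊥-elim (∈-∅ z∈∅)) e∈w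

  ω-suc : ∀ {n} → n ∈ ω → suc n ∈ ω
  ω-suc {n} n∈ω = from ∈-sep (closed (proj₁ infinity) (proj₂ infinity) , closed)
    where
    closed : ∀ w → Inductive w → suc n ∈ w
    closed w ind@(_ , step) with step n (proj₂ (to ∈-sep n∈ω) w ind)
    ... | s , s∈w , eq = subst (_∈ w)
      (⊆-antisym (λ z z∈s → from ∈-suc (to (eq z) z∈s)) λ z z∈ → from (eq z) (to ∈-suc z∈)) s∈w

  -- The set of `n ∈ ω` satisfying `P` is inductive, and elements of `ω` lie in every inductive set.
  ω-induction : (P : V → Set ℓ) → P ∅ → (∀ {n} → n ∈ ω → P n → P (suc n)) →
                ∀ n → n ∈ ω → P n
  ω-induction P P∅ Psuc n n∈ω = proj₂ (to ∈-sep (proj₂ (to ∈-sep n∈ω) (sep ω P)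
    ( (∅ , from ∈-sep (ω-zero , P∅) , λ _ → ∈-∅)
    , λ x x∈ → let x∈ω , Px = to ∈-sep x∈ in
        suc x , from ∈-sep (ω-suc x∈ω , Psuc x∈ω Px) , λ _ → ∈-suc)))

  ω-ordinal : Ordinal ω
  ω-ordinal = transitive-ordinal
    (ω-induction (_⊆ ω) (λ _ → ⊥-elim ∘ ∈-∅) λ n∈ω n⊆ω z z∈ →
      [ n⊆ω z , (λ { refl → n∈ω }) ]′ (to ∈-suc z∈))
    (ω-induction Ordinal ((λ _ → ⊥-elim ∘ ∈-∅) , λ _ _ → ⊥-elim ∘ ∈-∅) λ _ → suc-ordinal)

  Infinite : V → Set ℓ
  Infinite κ = ω ⊆ κ

  -- Hilbert's hotel: shifting along ω ⊆ κ frees ∅ for the new element a.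
  suc-≼ : ∀ {a κ} → Infinite κ → a ≼ κ → suc a ≼ κ
  suc-≼ {a} {κ} ω⊆κ a≼κ with ≼-elim a≼κ
  ... | F , maps , inj = ≼-intro G mapsG injG
    where
    shift′ : ∀ x → Dec (x ∈ ω) → V
    shift′ x (yes _) = suc x
    shift′ x (no _)  = x
    shift : V → V
    shift x = shift′ x em
    G′ : ∀ x → Dec (x ≡ a) → V
    G′ x (yes _) = ∅
    G′ x (no _)  = shift (F x)
    G : V → V
    G x = G′ x em
    shift-maps : ∀ {x} → x ∈ κ → shift x ∈ κ
    shift-maps {x} x∈κ with em {x ∈ ω}
    ... | yes x∈ω = ω⊆κ _ (ω-suc x∈ω)
    ... | no _    = x∈κ
    shift-injective : ∀ {x y} → shift x ≡ shift y → x ≡ y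
    shift-injective {x} {y} eq with em {x ∈ ω} | em {y ∈ ω}
    ... | yes _   | yes _   = suc-injective eq
    ... | yes x∈ω | no y∉ω  = ⊥-elim (y∉ω (subst (_∈ ω) eq (ω-suc x∈ω)))
    ... | no x∉ω  | yes y∈ω = ⊥-elim (x∉ω (subst (_∈ ω) (sym eq) (ω-suc y∈ω)))
    ... | no _    | no _    = eq
    shift-nonzero : ∀ {x} → shift x ≢ ∅
    shift-nonzero {x} eq with em {x ∈ ω}
    ... | yes _  = ∈-∅ (subst (x ∈_) eq ∈-suc-self)
    ... | no x∉ω = x∉ω (subst (_∈ ω) (sym eq) ω-zero)
    ∈-a : ∀ {x} → x ∈ suc a → x ≢ a → x ∈ a
    ∈-a x∈ x≢a = [ id , ⊥-elim ∘ x≢a ]′ (to ∈-suc x∈)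
    mapsG : MapsTo G (suc a) κ
    mapsG {x} x∈ with em {x ≡ a}
    ... | yes _  = ω⊆κ _ ω-zero
    ... | no x≢a = shift-maps (maps (∈-a x∈ x≢a))
    injG : InjectiveOn G (suc a)
    injG {x} {y} x∈ y∈ eq with em {x ≡ a} | em {y ≡ a}
    ... | yes p | yes q = trans p (sym q)
    ... | yes _ | no _  = ⊥-elim (shift-nonzero (sym eq))
    ... | no _  | yes _ = ⊥-elim (shift-nonzero eq)
    ... | no p  | no q  = inj (∈-a x∈ p) (∈-a y∈ q) (shift-injective eq)

  -- If `α` were not below `κ⁺`, then `κ⁺ ⊆ α` would inject into `κ`.
  cardinal-successor-∋ : ∀ {κ⁺ κ α} → IsCardinalSuccessor κ⁺ κ → Ordinal α → α ≼ κ → α ∈ κ⁺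
  cardinal-successor-∋ (oκ⁺ , κ⁺⋠κ , _) oα α≼κ with ordinal-compare oα oκ⁺
  ... | inj₁ p           = p
  ... | inj₂ (inj₁ refl) = ⊥-elim (κ⁺⋠κ α≼κ)
  ... | inj₂ (inj₂ κ⁺∈α) =
    ⊥-elim (κ⁺⋠κ (≼-trans (⊆⇒≼ (proj₁ oα _ κ⁺∈α)) α≼κ))

  -- Suprema and limit points.

  ∈-sup : ∀ {a b m x} → m ∈ a → m ∈ b → x ∈ m → x ∈ sup (a ∩ b)
  ∈-sup m∈a m∈b x∈m = from ∈-⋃ (_ , from ∈-sep (m∈a , m∈b) , x∈m)

  ∈-sup⁻ : ∀ {a b x} → x ∈ sup (a ∩ b) → ∃[ m ] (m ∈ a × m ∈ b × x ∈ m)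
  ∈-sup⁻ p = let m , m∈ , x∈m = to ∈-⋃ p ; m∈a , m∈b = to ∈-sep m∈ in m , m∈a , m∈b , x∈m

  -- Restates the supremum equation as cofinality; the power set bound in `lim` follows from
  -- cofinality.
  ∈-lim : ∀ {a γ} → γ ∈ lim a ⇔ (Limit γ × (∀ ξ → ξ ∈ γ → ∃[ m ] (m ∈ a × m ∈ γ × ξ ∈ m)))
  ∈-lim {a} {γ} = mk⇔ fwd bwd
    where
    fwd : γ ∈ lim a → Limit γ × (∀ ξ → ξ ∈ γ → ∃[ m ] (m ∈ a × m ∈ γ × ξ ∈ m))
    fwd p with to ∈-sep p
    ... | _ , lγ , eq = lγ , λ ξ ξ∈γ → ∈-sup⁻ (subst (ξ ∈_) (sym eq) ξ∈γ)
    bwd : Limit γ × (∀ ξ → ξ ∈ γ → ∃[ m ] (m ∈ a × m ∈ γ × ξ ∈ m)) → γ ∈ lim a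
    bwd (lγ@((tγ , _) , _) , cof) = from ∈-sep
      ( from ∈-𝒫 (λ ξ ξ∈γ → let m , m∈a , _ , ξ∈m = cof ξ ξ∈γ in from ∈-⋃ (m , m∈a , ξ∈m))
      , lγ
      , ⊆-antisym
          (λ ξ p → let m , _ , m∈γ , ξ∈m = ∈-sup⁻ p in tγ m m∈γ ξ ξ∈m)
          (λ ξ ξ∈γ → let m , m∈a , m∈γ , ξ∈m = cof ξ ξ∈γ in ∈-sup m∈a m∈γ ξ∈m))

  -- Inverting an injection of `a` into `ω` enumerates the elements of `a` below `γ`, which are
  -- cofinal in `γ`.
  countable-lim-cofinal : ∀ {a γ} → Countable a → γ ∈ lim a → ∃[ f ] CofinalMap f ω γ
  countable-lim-cofinal {a} {γ} a≼ω γ∈lim with ≼-elim a≼ω | to ∈-lim γ∈lim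
  ... | E , mapsE , injE | (_ , (x₀ , x₀∈γ) , _) , cof =
    graph F ω , graph-function F ω maps , cofinal
    where
    Code : V → Set ℓ
    Code n = ∃[ m ] (m ∈ a × m ∈ γ × E m ≡ n)
    -- Numbers coding no element of `a` below `γ` get the default `x₀`, available because a limit
    -- ordinal is nonempty.
    F′ : ∀ {n} → Dec (Code n) → V
    F′ (yes (m , _)) = m
    F′ (no _)        = x₀
    F : V → V
    F n = F′ (em {Code n})
    maps : MapsTo F ω γ
    maps {n} _ with em {Code n}
    ... | yes (_ , _ , m∈γ , _) = m∈γ
    ... | no _                  = x₀∈γ
    F-E : ∀ {m} → m ∈ a → m ∈ γ → F (E m) ≡ m
    F-E {m} m∈a m∈γ with em {Code (E m)}
    -- The element chosen for the code `E m` is `m` itself, by injectivity of `E`.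
    ... | yes (_ , m′∈a , _ , eq) = injE m′∈a m∈a eq
    ... | no ¬code                = ⊥-elim (¬code (m , m∈a , m∈γ , refl))
    cofinal : ∀ ξ → ξ ∈ γ → ∃[ i ] ∃[ η ] (⟨ i , η ⟩ ∈ graph F ω × ξ ≤ₒ η)
    cofinal ξ ξ∈γ with cof ξ ξ∈γ
    ... | m , m∈a , m∈γ , ξ∈m = E m , m ,
      from (∈-graph F ω) (E m , mapsE m∈a , cong ⟨ E m ,_⟩ (sym (F-E m∈a m∈γ))) , inj₁ ξ∈m

  -- Club sets.

  tails-club : ∀ {κ ζ} → Ordinal κ → (∀ {ξ} → ξ ∈ κ → suc ξ ∈ κ) → ζ ∈ κ →
               IsClub κ (sep κ (ζ ∈_))
  tails-club {κ} {ζ} oκ@(tκ , cκ) κ-suc ζ∈κ = (λ _ → proj₁ ∘ to ∈-sep) , unbounded , closed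
    where
    unbounded : ∀ ξ → ξ ∈ κ → ∃[ η ] (η ∈ sep κ (ζ ∈_) × ξ ∈ η)
    unbounded ξ ξ∈κ with cκ ζ ξ ζ∈κ ξ∈κ
    ... | inj₁ p           = suc ξ , from ∈-sep (κ-suc ξ∈κ , from ∈-suc (inj₁ p)) , ∈-suc-self
    ... | inj₂ (inj₁ refl) = suc ξ , from ∈-sep (κ-suc ξ∈κ , ∈-suc-self) , ∈-suc-self
    ... | inj₂ (inj₂ p)    = suc ζ , from ∈-sep (κ-suc ζ∈κ , ∈-suc-self) , from ∈-suc (inj₁ p)
    closed : ∀ δ → δ ∈ κ → δ ∈ lim (sep κ (ζ ∈_)) → δ ∈ sep κ (ζ ∈_)
    closed δ δ∈κ δ∈lim with to ∈-lim δ∈lim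
    ... | ((tδ , _) , (x , x∈δ) , _) , cof with cof x x∈δ
    -- One element of the tail below `δ` already puts `ζ` below `δ`.
    ... | m , m∈ , m∈δ , _ = from ∈-sep (δ∈κ , tδ m m∈δ ζ (proj₂ (to ∈-sep m∈)))

  module _ (κ a : V) where

    -- Elements of `a` enter through their successors because they may themselves lie in `Γ`,
    -- whereas a successor is never a limit ordinal.
    successors-and-limits : V
    successors-and-limits = sep κ λ δ → (∃[ m ] (m ∈ a × δ ≡ suc m)) ⊎ δ ∈ lim a

    -- The hypothesis `κ ∈ lim a` makes `a` unbounded in `κ`. For closure, a limit point of this set
    -- is already a limit point of `a`.
    successors-and-limits-club : (∀ {ξ} → ξ ∈ κ → suc ξ ∈ κ) → κ ∈ lim a →
                                 IsClub κ successors-and-limits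
    successors-and-limits-club κ-suc κ∈lim = (λ _ → proj₁ ∘ to ∈-sep) , unbounded , closed
      where
      D = successors-and-limits
      unbounded : ∀ ξ → ξ ∈ κ → ∃[ η ] (η ∈ D × ξ ∈ η)
      unbounded ξ ξ∈κ with proj₂ (to ∈-lim κ∈lim) ξ ξ∈κ
      ... | m , m∈a , m∈κ , ξ∈m =
        suc m , from ∈-sep (κ-suc m∈κ , inj₁ (m , m∈a , refl)) , from ∈-suc (inj₁ ξ∈m)
      closed : ∀ δ → δ ∈ κ → δ ∈ lim D → δ ∈ D
      closed δ δ∈κ δ∈lim with to ∈-lim δ∈lim
      ... | lδ@((tδ , _) , _) , cof = from ∈-sep (δ∈κ , inj₂ (from ∈-lim (lδ , cof′)))
        where
        cof′ : ∀ ξ → ξ ∈ δ → ∃[ m ] (m ∈ a × m ∈ δ × ξ ∈ m)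
        -- Starting from `suc ξ` gains the strictness needed: `ξ ∈ suc m` would allow `ξ ≡ m`, while
        -- `suc ξ ∈ suc m` gives `ξ ∈ m`.
        cof′ ξ ξ∈δ with cof (suc ξ) (suc-limit lδ ξ∈δ)
        ... | d , d∈D , d∈δ , sξ∈d with proj₂ (to ∈-sep d∈D)
        ... | inj₁ (m , m∈a , refl) = m , m∈a , tδ d d∈δ m ∈-suc-self , ξ∈m (to ∈-suc sξ∈d)
          where
          ξ∈m : suc ξ ∈ m ⊎ suc ξ ≡ m → ξ ∈ m
          ξ∈m (inj₂ refl) = ∈-suc-self
          ξ∈m (inj₁ sξ∈m) = proj₁ (∈-ordinal (∈-ordinal (proj₁ lδ) d∈δ) ∈-suc-self) _ sξ∈m _ ∈-suc-self
        ... | inj₂ d∈lim with to ∈-lim d∈lim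
        ... | ((td , _) , _) , cofd with cofd ξ (td _ sξ∈d ξ ∈-suc-self)
        ... | m , m∈a , m∈d , ξ∈m = m , m∈a , tδ d d∈δ m m∈d , ξ∈m

module InSetting {ℓ : Level} {𝕌 : ZFC ℓ} (𝕊 : Setting 𝕌) where
  open SetTheory 𝕌
  open Setting 𝕊
  open Sets 𝕌

  -- The cardinals `ω₁` and `ω₂`, and `Hω₂`.

  ω∈ω₁ : ω ∈ ω₁
  ω∈ω₁ = cardinal-successor-∋ ω₁-spec ω-ordinal (⊆⇒≼ λ _ → id)

  ω₂-ordinal : Ordinal ω₂
  ω₂-ordinal = proj₁ ω₂-spec

  ω₂-suc : ∀ {α} → α ∈ ω₂ → suc α ∈ ω₂
  ω₂-suc α∈ω₂ = cardinal-successor-∋ ω₂-spec (suc-ordinal (∈-ordinal ω₂-ordinal α∈ω₂))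
    (suc-≼ (proj₁ (proj₁ ω₁-spec) ω ω∈ω₁) (proj₂ (proj₂ ω₂-spec) _ α∈ω₂))

  ω₂⊆Hω₂ : ω₂ ⊆ Hω₂
  ω₂⊆Hω₂ α α∈ω₂ = from (Hω₂-spec α)
    ( α
    , transitive-closure-self (proj₁ (∈-ordinal ω₂-ordinal α∈ω₂))
    , ⊆⇒≼ (proj₁ ω₂-ordinal α α∈ω₂)
    , λ ω₂≼α → proj₁ (proj₂ ω₂-spec) (≼-trans ω₂≼α (proj₂ (proj₂ ω₂-spec) α α∈ω₂)))

  -- Lets quantifiers over `Hω₂` reach all elements of its members, so that `is-suc` is absolute.
  Hω₂-transitive : Transitive Hω₂
  Hω₂-transitive x x∈H z z∈x with to (Hω₂-spec x) x∈H
  ... | t , (x⊆t , tt , _) , t≼ω₂ , ω₂⋠t = from (Hω₂-spec z)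
    ( s
    , ( (λ y y∈z → from ∈-sep (tt z (x⊆t z z∈x) y y∈z , λ u z⊆u _ → z⊆u y y∈z))
      , (λ y y∈s w w∈y → let y∈t , inAll = to ∈-sep y∈s in
           from ∈-sep (tt y y∈t w w∈y , λ u z⊆u tu → tu y (inAll u z⊆u tu) w w∈y))
      , λ u z⊆u tu y y∈s → proj₂ (to ∈-sep y∈s) u z⊆u tu)
    , ≼-trans s≼t t≼ω₂
    , λ ω₂≼s → ω₂⋠t (≼-trans ω₂≼s s≼t))
    where
    s : V
    -- The transitive closure of `z`, cut out of that of `x`: the intersection of all transitive
    -- sets including `z`.
    s = sep t λ y → ∀ u → z ⊆ u → Transitive u → y ∈ u
    s≼t : s ≼ t
    s≼t = ⊆⇒≼ λ _ → proj₁ ∘ to ∈-sep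

  -- Skolem hulls and successors.

  module Skolem where
    open Structure 𝕌 Hω₂ π 𝒴 using (_⊨_; base; close)
    open Structure.SkolemFunctions skolemFunctions using (fun; fun∈H; skolem)

    -- y ⊆ x, y ∈ x and x ⊆ y ∪ {y}, with x and y the variables 0 and 1.
    is-suc : Formula 2
    is-suc = conj (neg (ex (conj (mem 0F 2F) (neg (mem 0F 1F)))))
            (conj (mem 1F 0F)
                  (neg (ex (conj (mem 0F 1F) (conj (neg (mem 0F 2F)) (neg (0F ≐ 2F)))))))

    suc⊨is-suc : ∀ {y} → (suc y ∷ y ∷ []) ⊨ is-suc
    suc⊨is-suc =
      (λ { (_ , _ , z∈y , z∉) → z∉ (from ∈-suc (inj₁ z∈y)) }) ,
      ∈-suc-self ,
      λ { (_ , _ , z∈ , z∉y , z≢y) → [ z∉y , z≢y ]′ (to ∈-suc z∈) }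

    is-suc⇒suc : ∀ {x y} → x ∈ Hω₂ → y ∈ Hω₂ → (x ∷ y ∷ []) ⊨ is-suc → x ≡ suc y
    is-suc⇒suc {x} {y} x∈H y∈H (y⊆x , y∈x , x⊆suc) = ⊆-antisym
      (λ z z∈x → by-contradiction λ z∉ → x⊆suc
        ( z , Hω₂-transitive x x∈H z z∈x , z∈x
        , (λ z∈y → z∉ (from ∈-suc (inj₁ z∈y))) , λ z≡y → z∉ (from ∈-suc (inj₂ z≡y))))
      (λ z z∈ → [ (λ z∈y → by-contradiction λ z∉x → y⊆x (z , Hω₂-transitive y y∈H z z∈y , z∈y , z∉x))
                , (λ { refl → y∈x }) ]′ (to ∈-suc z∈))

    -- At `y` the formula `is-suc` has `suc y` as its only witness in `Hω₂`, so its Skolem function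
    -- must return `suc y`.
    SkClosed-suc : ∀ {M y} → SkClosed M → y ∈ ω₂ → y ∈ M → suc y ∈ M
    SkClosed-suc {M} {y} closed y∈ω₂ y∈M = to (closed (suc y))
      (subst (Sk M) value (close is-suc (y ∷ []) (base y∈M ∷ [])) , ω₂-suc y∈ω₂)
      where
      y∈H = ω₂⊆Hω₂ y y∈ω₂
      value : fun is-suc (y ∷ []) ≡ suc y
      value = is-suc⇒suc (fun∈H is-suc _ (y∈H ∷ [])) y∈H
        (skolem is-suc _ (y∈H ∷ []) (suc y , ω₂⊆Hω₂ _ (ω₂-suc y∈ω₂) , suc⊨is-suc))

  open Skolem using (SkClosed-suc)

  -- Cofinality, and the members of `𝒳`.

  countable-lim-not-cofinality-ω₁ : ∀ {a γ} → Countable a → γ ∈ lim a → ¬ HasCofinality γ ω₁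
  countable-lim-not-cofinality-ω₁ count γ∈lim (_ , _ , noShorter) =
    noShorter ω ω∈ω₁ (countable-lim-cofinal count γ∈lim)

  module _ {M : V} (M∈𝒳 : M ∈ 𝒳) where

    private
      M∈Pω₁ = to ∈-sep (proj₁ 𝒴-stationary M (proj₁ (to ∈-sep M∈𝒳)))

    𝒳-⊆ω₂ : M ⊆ ω₂
    𝒳-⊆ω₂ = to ∈-𝒫 (proj₁ M∈Pω₁)

    𝒳-countable : Countable M
    𝒳-countable = proj₂ M∈Pω₁

    𝒳-suc : ∀ {y} → y ∈ M → suc y ∈ M
    𝒳-suc y∈M = SkClosed-suc (proj₁ (proj₂ (to ∈-sep M∈𝒳))) (𝒳-⊆ω₂ _ y∈M) y∈M

  -- The stationary set `Γ` and its comparison points.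

  module _ {Γ : V} (Γ⊆Λ : Γ ⊆ Λ) (stat : Stationary ω₂ Γ) where

    Γ-cofinality : ∀ {ξ} → ξ ∈ Γ → HasCofinality ξ ω₁
    Γ-cofinality ξ∈Γ = proj₁ (proj₂ (to ∈-sep (Γ⊆Λ _ ξ∈Γ)))

    Γ-limit : ∀ {ξ} → ξ ∈ Γ → Limit ξ
    Γ-limit ξ∈Γ = proj₁ (to ∈-lim (proj₂ (proj₂ (to ∈-sep (Γ⊆Λ _ ξ∈Γ)))))

    ω₂∉lim-countable : ∀ {a} → Countable a → ¬ (ω₂ ∈ lim a)
    ω₂∉lim-countable {a} count ω₂∈lim =
      disjoint (proj₂ stat D (successors-and-limits-club ω₂ a ω₂-suc ω₂∈lim))
      where
      D : V
      D = successors-and-limits ω₂ a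
      disjoint : ¬ (∃[ x ] (x ∈ D × x ∈ Γ))
      disjoint (x , x∈D , x∈Γ) with proj₂ (to ∈-sep x∈D)
      ... | inj₁ (_ , _ , eq) = suc-not-limit (subst Limit eq (Γ-limit x∈Γ))
      ... | inj₂ x∈lim        =
        countable-lim-not-cofinality-ω₁ count x∈lim (Γ-cofinality x∈Γ)

    -- Stationarity makes `Γ` meet the tail of `ω₂` above `ζ`; the well-order then supplies the
    -- least such point.
    Γ-next : ∀ {ζ} → ζ ∈ ω₂ → ∃[ μ ] (μ ∈ Γ × ζ ∈ μ × (∀ ξ → ξ ∈ Γ → ζ ∈ ξ → μ ≤ₒ ξ))
    Γ-next {ζ} ζ∈ω₂ = next (proj₂ stat D (tails-club ω₂-ordinal ω₂-suc ζ∈ω₂))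
      where
      D : V
      D = sep ω₂ (ζ ∈_)
      next : ∃[ x ] (x ∈ D × x ∈ Γ) → ∃[ μ ] (μ ∈ Γ × ζ ∈ μ × (∀ ξ → ξ ∈ Γ → ζ ∈ ξ → μ ≤ₒ ξ))
      next (x , x∈D , x∈Γ) =
        let x∈ω₂ , ζ∈x = to ∈-sep x∈D
            μ , _ , (μ∈Γ , ζ∈μ) , least =
              least-ordinal (λ ξ → ξ ∈ Γ × ζ ∈ ξ) ω₂-ordinal (x , x∈ω₂ , x∈Γ , ζ∈x)
        in μ , μ∈Γ , ζ∈μ , λ ξ ξ∈Γ ζ∈ξ → least ξ (proj₁ stat ξ ξ∈Γ) (ξ∈Γ , ζ∈ξ)

    -- By its definition `lim M` could contain `ω₂` itself, if `M` were unbounded; stationarity of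
    -- `Γ` excludes this. A limit point beyond `ω₂` would require an element of `M` above `ω₂`.
    lim-𝒳-⊆ω₂ : ∀ {M} → M ∈ 𝒳 → lim M ⊆ ω₂
    lim-𝒳-⊆ω₂ M∈𝒳 z z∈lim with to ∈-lim z∈lim
    ... | (oz , _) , cof with ordinal-compare oz ω₂-ordinal
    ...   | inj₁ p           = p
    ...   | inj₂ (inj₁ refl) = ⊥-elim (ω₂∉lim-countable (𝒳-countable M∈𝒳) z∈lim)
    ...   | inj₂ (inj₂ ω₂∈z) with cof ω₂ ω₂∈z
    ...     | m , m∈M , _ , ω₂∈m = ⊥-elim (∈-asym ω₂∈m (𝒳-⊆ω₂ M∈𝒳 m m∈M))

    closure-⊆ω₂ : ∀ {M} → M ∈ 𝒳 → M ∪ lim M ⊆ ω₂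
    closure-⊆ω₂ M∈𝒳 z z∈ = [ 𝒳-⊆ω₂ M∈𝒳 z , lim-𝒳-⊆ω₂ M∈𝒳 z ]′ (to ∈-∪ z∈)

    next-∈-comparison : ∀ {M z μ} → M ∈ 𝒳 → z ∈ M ∪ lim M → μ ∈ Γ → z ∈ μ →
                        (∀ ξ → ξ ∈ Γ → z ∈ ξ → μ ≤ₒ ξ) → μ ∈ comparison Γ M
    next-∈-comparison {M} {z} {μ} M∈𝒳 z∈M′ μ∈Γ z∈μ least = from ∈-sep
      (μ∈Γ , from ∈-sep (μ∈Γ , μ∉sup) , isLeast)
      where
      oz : Ordinal z
      oz = ∈-ordinal ω₂-ordinal (closure-⊆ω₂ M∈𝒳 z z∈M′)
      μ∉sup : ¬ (μ ∈ sup (M ∩ μ))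
      μ∉sup p = let m , _ , m∈μ , μ∈m = ∈-sup⁻ p in ∈-asym m∈μ μ∈m
      below-z : ∀ {ξ} → ξ ∈ z → ξ ∈ sup (M ∩ μ)
      below-z {ξ} ξ∈z with to ∈-∪ z∈M′
      ... | inj₁ z∈M = ∈-sup z∈M z∈μ ξ∈z
      ... | inj₂ z∈lim with proj₂ (to ∈-lim z∈lim) ξ ξ∈z
      ...   | m , m∈M , m∈z , ξ∈m = ∈-sup m∈M (proj₁ (proj₁ (Γ-limit μ∈Γ)) z z∈μ m m∈z) ξ∈m
      -- The point `z` needs separate care: `z ∈ M` by itself only yields `z ⊆ sup (M ∩ μ)`. As `μ`
      -- is a limit, `suc z` is also in `M ∩ μ`, and it contains `z`.
      at-z : z ∈ Γ → z ∈ sup (M ∩ μ)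
      at-z z∈Γ with to ∈-∪ z∈M′
      ... | inj₁ z∈M   = ∈-sup (𝒳-suc M∈𝒳 z∈M) (suc-limit (Γ-limit μ∈Γ) z∈μ) ∈-suc-self
      ... | inj₂ z∈lim =
        ⊥-elim (countable-lim-not-cofinality-ω₁ (𝒳-countable M∈𝒳) z∈lim (Γ-cofinality z∈Γ))
      isLeast : ∀ ξ → ξ ∈ Γ ∖ sup (M ∩ μ) → μ ≤ₒ ξ
      isLeast ξ ξ∈ with to ∈-sep ξ∈
      ... | ξ∈Γ , ξ∉sup with ordinal-compare (proj₁ (Γ-limit ξ∈Γ)) oz
      ...   | inj₁ ξ∈z         = ⊥-elim (ξ∉sup (below-z ξ∈z))
      ...   | inj₂ (inj₁ refl) = ⊥-elim (ξ∉sup (at-z ξ∈Γ))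
      ...   | inj₂ (inj₂ z∈ξ)  = least ξ ξ∈Γ z∈ξ

proposition2p6 : ∀ {ℓ} (𝕌 : ZFC ℓ) (𝕊 : Setting 𝕌) →
    let open SetTheory 𝕌
        open Setting 𝕊
    in ∀ Γ → Γ ⊆ Λ → Stationary ω₂ Γ →
       ∀ M N → M ∈ 𝒳 → N ∈ 𝒳 →
       ∀ β → IsLargest β (comparison Γ M ∩ comparison Γ N) →
       (M ∪ lim M) ∩ (N ∪ lim N) ⊆ β
proposition2p6 𝕌 𝕊 Γ Γ⊆Λ stat M N M∈𝒳 N∈𝒳 β (β∈ , largest) z z∈ = conclusion
  where
  open SetTheory 𝕌
  open Setting 𝕊
  open Sets 𝕌
  open InSetting 𝕊

  z∈M′ : z ∈ M ∪ lim M
  z∈M′ = proj₁ (to ∈-sep z∈)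

  z∈ω₂ : z ∈ ω₂
  z∈ω₂ = closure-⊆ω₂ Γ⊆Λ stat M∈𝒳 z z∈M′

  -- This is what makes `β` an ordinal, comparable with `z`.
  β∈Γ : β ∈ Γ
  β∈Γ = proj₁ (to ∈-sep (proj₁ (to ∈-sep β∈)))

  β≰z : ¬ (β ≤ₒ z)
  β≰z β≤z = contradiction (Γ-next Γ⊆Λ stat z∈ω₂)
    where
    contradiction : ¬ (∃[ μ ] (μ ∈ Γ × z ∈ μ × (∀ ξ → ξ ∈ Γ → z ∈ ξ → μ ≤ₒ ξ)))
    contradiction (μ , μ∈Γ , z∈μ , least) = [ ∈-asym β∈μ , (λ { refl → ∈-irrefl β∈μ }) ]′ μ≤β
      where
      β∈μ : β ∈ μ
      β∈μ = [ proj₁ (proj₁ (Γ-limit Γ⊆Λ stat μ∈Γ)) z z∈μ β , (λ { refl → z∈μ }) ]′ β≤z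
      μ≤β : μ ≤ₒ β
      -- The same `μ` serves both models, since it depends only on `z` and `Γ`.
      μ≤β = largest μ (from ∈-sep
        ( next-∈-comparison Γ⊆Λ stat M∈𝒳 z∈M′ μ∈Γ z∈μ least
        , next-∈-comparison Γ⊆Λ stat N∈𝒳 (proj₂ (to ∈-sep z∈)) μ∈Γ z∈μ least))

  conclusion : z ∈ β
  conclusion =
    [ id , (λ β≤z → ⊥-elim (β≰z ([ inj₂ ∘ sym , inj₁ ]′ β≤z))) ]′
      (ordinal-compare (∈-ordinal ω₂-ordinal z∈ω₂) (proj₁ (Γ-limit Γ⊆Λ stat β∈Γ)))
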